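{- We have $$f_{0000}(x)=1+\frac{x(1-3x+3x^3+11x^4-3x^5-19x^6-9x^7+11x^8+14x^9+11x^{10}+4x^{11}+x^{12})}{(1-x-x^2-x^3)^5}$$ as formal power series in $x$, where $f_{0000}(x)=\sum_{n\ge 0} b_n(0000)x^n$ and $b_n(0000)$ is the number of ascent sequences of length $n$ that avoid both patterns $021$ and $0000$.
   Context: For a finite sequence $w=w_1\cdots w_n$ of integers, $\mathrm{asc}(w)$ is the number of indices $1\le i\le n-1$ with $w_i<w_{i+1}$. An ascent sequence of length $n\ge 1$ is a sequence $a_1\cdots a_n$ of non-negative integers such that $a_1=0$ and $a_i\le \mathrm{asc}(a_1\cdots a_{i-1})+1$ for $1<i\le n$; there is exactly one (empty) ascent sequence of length $0$. A sequence $\pi=\pi_1\cdots\pi_n$ contains a pattern $\tau=\tau_1\cdots\tau_m$ if there are indices $1\le i_1<\cdots<i_m\le n$ such that for all $j,k\in\{1,\dots,m\}$: $\pi_{i_j}<\pi_{i_k}$ iff $\tau_j<\tau_k$, and $\pi_{i_j}=\pi_{i_k}$ iff $\tau_j=\tau_k$; otherwise $\pi$ avoids $\tau$. For a pattern $\tau$, $B_n(\tau)$ is the set of ascent sequences of length $n$ avoiding both $021$ and $\tau$ (with $B_0(\tau)$ consisting of the empty sequence), and $b_n(\tau)=|B_n(\tau)|$. -}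

module Defs where

open import Data.Bool.Base using (true; false; if_then_else_)
open import Data.Fin.Base as Fin using (Fin; zero; suc; toℕ)
import Data.Fin.Properties as Fin
open import Data.Integer.Base as ℤ using (ℤ; +_; 0ℤ; 1ℤ)
import Data.Integer.Properties as ℤ
open import Data.Integer.Tactic.RingSolver using (solve-∀)
open import Data.List.Base
  using (List; []; _∷_; length; lookup; take; upTo; filter; cartesianProductWith)
open import Data.List.Membership.Propositional using (_∈_)
open import Data.List.Membership.Propositional.Properties
  using (∈-cartesianProductWith⁺; ∈-cartesianProductWith⁻; ∈-filter⁺; ∈-filter⁻; ∈-upTo⁺)
open import Data.List.Properties using (length-take; ∷-injective)
open import Data.List.Relation.Unary.All as All using (All; []; _∷_)
open import Data.List.Relation.Unary.AllPairs using ([]; _∷_)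
open import Data.List.Relation.Unary.Any using (here; index)
open import Data.List.Relation.Unary.Any.Properties using (lookup-index)
open import Data.List.Relation.Unary.Unique.Propositional using (Unique)
import Data.List.Relation.Unary.Unique.Propositional.Properties as Unique
open import Data.Nat.Base as ℕ using (ℕ; zero; suc; _≤_; _<_; _∸_; z≤n; s≤s)
import Data.Nat.Properties as ℕ
open import Data.Product.Base using (∃; _×_; _,_; proj₁; proj₂)
open import Data.Vec.Base as Vec using (Vec; []; _∷_)
open import Function.Base using (_∘_)
open import Function.Bundles using (_⇔_; mk⇔; Equivalence)
open import Relation.Binary.PropositionalEquality
  using (_≡_; refl; sym; trans; cong; cong₂; subst)
open import Relation.Nullary using (¬_; Dec; does; map′; ¬?; _×-dec_; _→-dec_)
open import Relation.Nullary.Decidable using (True; toWitness)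
open import Relation.Unary using (Decidable)

open import Algebra.Properties.CommutativeMonoid.Sum ℤ.+-0-commutativeMonoid
  using (sum⁺-syntax)

asc : List ℕ → ℕ
asc []          = 0
asc (_ ∷ [])    = 0
asc (x ∷ y ∷ w) = if does (x ℕ.<? y) then suc (asc (y ∷ w)) else asc (y ∷ w)

-- Positions are 0-based, so the entries strictly before position i are
-- take (toℕ i) w.
IsAscentSequence : List ℕ → Set
IsAscentSequence w =
    (∀ (i : Fin (length w)) → toℕ i ≡ 0 → lookup w i ≡ 0)
  × (∀ (i : Fin (length w)) → 0 < toℕ i → lookup w i ≤ asc (take (toℕ i) w) ℕ.+ 1)

StrictlyIncreasing : ∀ {m n} → Vec (Fin n) m → Set
StrictlyIncreasing i = ∀ j k → j Fin.< k → Vec.lookup i j Fin.< Vec.lookup i k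

IsOccurrence : (τ π : List ℕ) → Vec (Fin (length π)) (length τ) → Set
IsOccurrence τ π i =
    StrictlyIncreasing i
  × (∀ j k → (π[i j ] < π[i k ] ⇔ lookup τ j < lookup τ k)
           × (π[i j ] ≡ π[i k ] ⇔ lookup τ j ≡ lookup τ k))
  where
  π[i_] : Fin (length τ) → ℕ
  π[i j ] = lookup π (Vec.lookup i j)

Contains : (π τ : List ℕ) → Set
Contains π τ = ∃ λ i → IsOccurrence τ π i

Avoids : (π τ : List ℕ) → Set
Avoids π τ = ¬ Contains π τ

IsAvoidingAscentSequence : (τ w : List ℕ) → Set
IsAvoidingAscentSequence τ w =
  IsAscentSequence w × Avoids w (0 ∷ 2 ∷ 1 ∷ []) × Avoids w τ

private
  infix 4 _⇔-dec_

  _⇔-dec_ : {A B : Set} → Dec A → Dec B → Dec (A ⇔ B)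
  a ⇔-dec b = map′ (λ (f , g) → mk⇔ f g) (λ e → Equivalence.to e , Equivalence.from e)
                   ((a →-dec b) ×-dec (b →-dec a))

  anyVec? : ∀ {n} m {P : Vec (Fin n) m → Set} → Decidable P → Dec (∃ P)
  anyVec? zero    P? = map′ ([] ,_) (λ { ([] , p) → p }) (P? [])
  anyVec? (suc m) P? =
    map′ (λ (i , is , p) → (i ∷ is) , p) (λ { (i ∷ is , p) → i , is , p })
         (Fin.any? λ i → anyVec? m λ is → P? (i ∷ is))

isAscentSequence? : Decidable IsAscentSequence
isAscentSequence? w =
  Fin.all? (λ i → (toℕ i ℕ.≟ 0) →-dec (lookup w i ℕ.≟ 0))
  ×-dec
  Fin.all? (λ i → (0 ℕ.<? toℕ i) →-dec (lookup w i ℕ.≤? asc (take (toℕ i) w) ℕ.+ 1))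

contains? : ∀ π τ → Dec (Contains π τ)
contains? π τ = anyVec? (length τ) λ i →
  Fin.all? (λ j → Fin.all? λ k →
    (j Fin.<? k) →-dec (Vec.lookup i j Fin.<? Vec.lookup i k))
  ×-dec
  Fin.all? (λ j → Fin.all? λ k →
    let πj = lookup π (Vec.lookup i j) ; πk = lookup π (Vec.lookup i k) in
    ((πj ℕ.<? πk) ⇔-dec (lookup τ j ℕ.<? lookup τ k))
    ×-dec
    ((πj ℕ.≟ πk) ⇔-dec (lookup τ j ℕ.≟ lookup τ k)))

isAvoidingAscentSequence? : ∀ τ → Decidable (IsAvoidingAscentSequence τ)
isAvoidingAscentSequence? τ w =
  isAscentSequence? w ×-dec ¬? (contains? w (0 ∷ 2 ∷ 1 ∷ [])) ×-dec ¬? (contains? w τ)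

words : List ℕ → ℕ → List (List ℕ)
words alphabet zero    = [] ∷ []
words alphabet (suc n) = cartesianProductWith _∷_ alphabet (words alphabet n)

-- Every entry of an ascent sequence of length n is less than n, so filtering
-- the words over {0, …, n-1} loses nothing; see ∈-B and B-unique.
B : List ℕ → ℕ → List (List ℕ)
B τ n = filter (isAvoidingAscentSequence? τ) (words (upTo n) n)

b : List ℕ → ℕ → ℕ
b τ n = length (B τ n)

private
  ∈-words⁺ : ∀ {xs w} → All (_∈ xs) w → w ∈ words xs (length w)
  ∈-words⁺ []       = here refl
  ∈-words⁺ (p ∷ ps) = ∈-cartesianProductWith⁺ _∷_ p (∈-words⁺ ps)

  ∈-words⁻ : ∀ xs n {w} → w ∈ words xs n → length w ≡ n
  ∈-words⁻ xs zero    (here refl) = refl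
  ∈-words⁻ xs (suc n) w∈
    with _ , _ , _ , v∈ , refl ← ∈-cartesianProductWith⁻ _∷_ xs (words xs n) w∈
    = cong suc (∈-words⁻ xs n v∈)

  words-unique : ∀ {xs} → Unique xs → ∀ n → Unique (words xs n)
  words-unique u zero    = [] ∷ []
  words-unique u (suc n) = Unique.cartesianProductWith⁺ _∷_ ∷-injective u (words-unique u n)

  asc<length : ∀ x w → asc (x ∷ w) < length (x ∷ w)
  asc<length x []      = s≤s z≤n
  asc<length x (y ∷ w) with does (x ℕ.<? y)
  ... | true  = s≤s (asc<length y w)
  ... | false = ℕ.m≤n⇒m≤1+n (asc<length y w)

  asc-take : ∀ n w → 0 < n → n ≤ length w → asc (take n w) ℕ.+ 1 ≤ n
  asc-take (suc n) (x ∷ w) _ (s≤s n≤) = begin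
    asc (x ∷ take n w) ℕ.+ 1  ≡⟨ ℕ.+-comm _ 1 ⟩
    suc (asc (x ∷ take n w))  ≤⟨ asc<length x (take n w) ⟩
    suc (length (take n w))   ≡⟨ cong suc (trans (length-take n w) (ℕ.m≤n⇒m⊓n≡m n≤)) ⟩
    suc n                     ∎
    where open ℕ.≤-Reasoning

  entry≤position : ∀ w → IsAscentSequence w → ∀ i → lookup w i ≤ toℕ i
  entry≤position w (first , rest) i with toℕ i in eq
  ... | zero  = ℕ.≤-reflexive (first i eq)
  ... | suc k = ℕ.≤-trans
    (subst (λ m → lookup w i ≤ asc (take m w) ℕ.+ 1) eq
      (rest i (subst (0 <_) (sym eq) (s≤s z≤n))))
    (asc-take (suc k) w (s≤s z≤n) (subst (_≤ length w) eq (ℕ.<⇒≤ (Fin.toℕ<n i))))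

  entries∈upTo : ∀ w → IsAscentSequence w → All (_∈ upTo (length w)) w
  entries∈upTo w a = All.tabulate λ x∈w → ∈-upTo⁺ (subst (_< length w)
    (sym (lookup-index x∈w))
    (ℕ.≤-<-trans (entry≤position w a (index x∈w)) (Fin.toℕ<n (index x∈w))))

∈-B : ∀ τ n w → w ∈ B τ n ⇔ (length w ≡ n × IsAvoidingAscentSequence τ w)
∈-B τ n w = mk⇔ to from
  where
  to : w ∈ B τ n → length w ≡ n × IsAvoidingAscentSequence τ w
  to w∈B with w∈words , p ← ∈-filter⁻ {P = IsAvoidingAscentSequence τ} (isAvoidingAscentSequence? τ)
                              {v = w} {xs = words (upTo n) n} w∈B
    = ∈-words⁻ (upTo n) n w∈words , p

  from : length w ≡ n × IsAvoidingAscentSequence τ w → w ∈ B τ n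
  from (refl , p) = ∈-filter⁺ {P = IsAvoidingAscentSequence τ} (isAvoidingAscentSequence? τ)
    {x = w} {xs = words (upTo (length w)) (length w)} (∈-words⁺ (entries∈upTo w (proj₁ p))) p

B-unique : ∀ τ n → Unique (B τ n)
B-unique τ n = Unique.filter⁺ (isAvoidingAscentSequence? τ) (words-unique (Unique.upTo⁺ n) n)

-- A series is its sequence of coefficients.
Series : Set
Series = ℕ → ℤ

infix  4 _≈_
infixl 6 _+_
infixl 7 _*_ _/_
infixr 8 _^_

_≈_ : Series → Series → Set
F ≈ G = ∀ n → F n ≡ G n

-- poly (c₀ ∷ c₁ ∷ … ∷ []) is c₀ + c₁ x + ….
poly : List ℤ → Series
poly []       _       = 0ℤ
poly (c ∷ _)  zero    = c
poly (_ ∷ cs) (suc n) = poly cs n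

one : Series
one = poly (1ℤ ∷ [])

X : Series
X = poly (0ℤ ∷ 1ℤ ∷ [])

_+_ : Series → Series → Series
(F + G) n = F n ℤ.+ G n

_*_ : Series → Series → Series
(F * G) n = ∑[ k ≤ n ] (F (toℕ k) ℤ.* G (n ∸ toℕ k))

_^_ : Series → ℕ → Series
F ^ zero  = one
F ^ suc k = F * F ^ k

-- (F - F₀ D) / x, when D has constant term 1.
remainder : Series → Series → Series
remainder F D n = F (suc n) ℤ.- F 0 ℤ.* D (suc n)

-- Long division by a series with constant term 1: if Q D = F, then Q = F₀ + x Q′
-- with Q′ D = remainder F D. See /-* and /-unique.
_/_ : (F D : Series) {_ : True (D 0 ℤ.≟ 1ℤ)} → Series
(F / D)         zero    = F 0
_/_ F D {D₀≡1} (suc n) = _/_ (remainder F D) D {D₀≡1} n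

private
  *-head : ∀ Q D → D 0 ≡ 1ℤ → (Q * D) 0 ≡ Q 0
  *-head Q D D₀ = trans (ℤ.+-identityʳ _) (trans (cong (Q 0 ℤ.*_) D₀) (ℤ.*-identityʳ (Q 0)))

  a+[b-a] : ∀ a b → a ℤ.+ (b ℤ.- a) ≡ b
  a+[b-a] = solve-∀

  b≡[a+b]-a : ∀ a b → b ≡ (a ℤ.+ b) ℤ.- a
  b≡[a+b]-a = solve-∀

/-* : ∀ F D {D₀≡1 : True (D 0 ℤ.≟ 1ℤ)} → _/_ F D {D₀≡1} * D ≈ F
/-* F D {D₀≡1} zero    = *-head (_/_ F D {D₀≡1}) D (toWitness D₀≡1)
/-* F D {D₀≡1} (suc n) =
  trans (cong (λ z → F 0 ℤ.* D (suc n) ℤ.+ z) (/-* (remainder F D) D {D₀≡1} n)) (a+[b-a] (F 0 ℤ.* D (suc n)) (F (suc n)))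

/-unique : ∀ F D {D₀≡1 : True (D 0 ℤ.≟ 1ℤ)} Q → Q * D ≈ F → Q ≈ _/_ F D {D₀≡1}
/-unique F D {D₀≡1} Q QD≈F zero =
  trans (sym (*-head Q D (toWitness D₀≡1))) (QD≈F 0)
/-unique F D {D₀≡1} Q QD≈F (suc n) = /-unique (remainder F D) D {D₀≡1} (Q ∘ suc) Q′D≈F′ n
  where
  Q₀≡F₀ : Q 0 ≡ F 0
  Q₀≡F₀ = /-unique F D {D₀≡1} Q QD≈F zero

  Q′D≈F′ : (Q ∘ suc) * D ≈ remainder F D
  Q′D≈F′ m = trans (b≡[a+b]-a (Q 0 ℤ.* D (suc m)) _)
    (cong₂ ℤ._-_ (QD≈F (suc m)) (cong (ℤ._* D (suc m)) Q₀≡F₀))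

f : List ℕ → Series
f τ n = + b τ n

{-# OPTIONS --safe #-}
-- A word 0w is an ascent sequence avoiding 021 and 0000 exactly when the nonzero entries of w
-- increase weakly, each value occurs at most three times, and no entry overtakes the number of
-- ascents before it by more than one.  Read from left to right, these conditions depend on
-- boundedly much of the prefix: how many zeros and how many copies of the maximum m are still
-- allowed, whether the last entry is 0, and the slack asc - m.  A zero placed between two copies of
-- m earns one unit of slack, and a rise from m to m + 1 + j spends j units, so the slack never
-- exceeds 2.  The words are thus the paths of a finite automaton, and their generating functions
-- are the only solution of a linear system, which is solved over the common denominator
-- (1 - x - x² - x³)⁵.
module Submission where

open import Defs
open import Data.Bool.Base using (Bool; true; false; if_then_else_)
import Data.Bool.Properties as Bool
open import Data.Empty using (⊥; ⊥-elim)
open import Data.Fin using (#_)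
open import Data.Fin.Base as Fin using (Fin; zero; suc; toℕ)
import Data.Fin.Properties as Fin
open import Data.Integer.Base using (+_; -_)
open import Data.Integer.Base as ℤ using (ℤ; 0ℤ; 1ℤ)
import Data.Integer.Properties as ℤ
open import Data.Integer.Tactic.RingSolver using (solve-∀)
open import Data.List.Base using ([]; _∷_)
open import Data.List.Base
  using (List; _++_; map; foldr; filter; length; lookup; take; concatMap; applyUpTo)
open import Data.List.Membership.Propositional using (_∈_)
open import Data.List.Membership.Propositional.Properties
  using (∈-map⁺; ∈-map⁻; ∈-concatMap⁺; ∈-concatMap⁻; ∈-lookup)
open import Data.List.Membership.Propositional.Properties.WithK using (unique∧set⇒bag)
open import Data.List.Properties
  using ( filter-accept; filter-reject; filter-none; take-all; tabulate-lookup
        ; length-++; length-map; ∷-injectiveˡ; ∷-injectiveʳ)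
open import Data.List.Relation.Binary.BagAndSetEquality using (∼bag⇒↭)
open import Data.List.Relation.Binary.Disjoint.Propositional using (Disjoint)
open import Data.List.Relation.Binary.Permutation.Propositional.Properties using (↭-length)
open import Data.List.Relation.Unary.All as All using (All; []; _∷_; all?)
import Data.List.Relation.Unary.All.Properties as All
open import Data.List.Relation.Unary.AllPairs as AllPairs using (AllPairs; []; _∷_)
import Data.List.Relation.Unary.AllPairs.Properties as AllPairs
open import Data.List.Relation.Unary.Any as Any using (Any; here; there)
import Data.List.Relation.Unary.Any.Properties as Any
open import Data.List.Relation.Unary.Unique.Propositional using (Unique)
import Data.List.Relation.Unary.Unique.Propositional.Properties as Unique
open import Data.Nat.Base as ℕ
  using (ℕ; zero; suc; _∸_; _≤_; _<_; _⊔_; z≤n; s≤s; z<s; s<s)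
open import Data.Nat.ListAction using (sum)
import Data.Nat.Properties as ℕ
open import Data.Product.Base using (∃; _×_; _,_; proj₁; proj₂)
open import Data.Product.Properties using (≡-dec)
open import Data.Sum.Base using (_⊎_; inj₁; inj₂)
open import Data.Vec.Base as Vec using (Vec; []; _∷_)
import Data.Vec.Properties as Vec
open import Function.Base using (_∘_; id; const; case_of_)
open import Function.Bundles using (_⇔_; mk⇔; Equivalence)
open import Relation.Binary.Definitions using (DecidableEquality; tri<; tri≈; tri>)
open import Relation.Binary.PropositionalEquality
open import Relation.Nullary using (Dec; does; yes; no; ¬_; contradiction; map′; _×-dec_)
open import Relation.Nullary.Decidable using (True; toWitness; dec-true; dec-false)

open Equivalence

-- Polynomials and series division

≈-trans : ∀ {F G H} → F ≈ G → G ≈ H → F ≈ H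
≈-trans p q n = trans (p n) (q n)

*-congˡ : ∀ F {G H} → G ≈ H → F * G ≈ F * H
*-congˡ F p zero    = cong (λ z → F 0 ℤ.* z ℤ.+ 0ℤ) (p 0)
*-congˡ F p (suc n) = cong₂ ℤ._+_ (cong (F 0 ℤ.*_) (p (suc n))) (*-congˡ (F ∘ suc) p n)

infixl 6 _⊞_
infixl 7 _⊛_
infixr 8 _⊛^_

-- Polynomials are handled as coefficient lists because these can be computed and compared, whereas
-- a `Series` is a function on all of `ℕ`.
_⊞_ : List ℤ → List ℤ → List ℤ
[]      ⊞ q       = q
p       ⊞ []      = p
(a ∷ p) ⊞ (b ∷ q) = (a ℤ.+ b) ∷ (p ⊞ q)

_⊛_ : List ℤ → List ℤ → List ℤ
[]      ⊛ q = []
(a ∷ p) ⊛ q = map (a ℤ.*_) q ⊞ (0ℤ ∷ p ⊛ q)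

_⊛^_ : List ℤ → ℕ → List ℤ
p ⊛^ zero  = 1ℤ ∷ []
p ⊛^ suc k = p ⊛ p ⊛^ k

poly-⊞ : ∀ p q → poly (p ⊞ q) ≈ poly p + poly q
poly-⊞ []      q       n       = sym (ℤ.+-identityˡ (poly q n))
poly-⊞ (a ∷ p) []      n       = sym (ℤ.+-identityʳ (poly (a ∷ p) n))
poly-⊞ (a ∷ p) (b ∷ q) zero    = refl
poly-⊞ (a ∷ p) (b ∷ q) (suc n) = poly-⊞ p q n

poly-map-* : ∀ a p n → poly (map (a ℤ.*_) p) n ≡ a ℤ.* poly p n
poly-map-* a []      n       = sym (ℤ.*-zeroʳ a)
poly-map-* a (b ∷ p) zero    = refl
poly-map-* a (b ∷ p) (suc n) = poly-map-* a p n

poly-⊛ : ∀ p q → poly (p ⊛ q) ≈ poly p * poly q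
poly-⊛ []      q zero    = refl
poly-⊛ []      q (suc n) = trans (poly-⊛ [] q n) (sym (ℤ.+-identityˡ _))
poly-⊛ (a ∷ p) q n = trans (poly-⊞ (map (a ℤ.*_) q) (0ℤ ∷ p ⊛ q) n)
  (trans (cong (ℤ._+ poly (0ℤ ∷ p ⊛ q) n) (poly-map-* a q n)) (step n))
  where
  step : ∀ n → a ℤ.* poly q n ℤ.+ poly (0ℤ ∷ p ⊛ q) n ≡ (poly (a ∷ p) * poly q) n
  step zero    = refl
  step (suc n) = cong (λ z → a ℤ.* poly q (suc n) ℤ.+ z) (poly-⊛ p q n)

poly-⊛^ : ∀ p k → poly (p ⊛^ k) ≈ poly p ^ k
poly-⊛^ p zero    n = refl
poly-⊛^ p (suc k)   = ≈-trans (poly-⊛ p (p ⊛^ k)) (*-congˡ (poly p) (poly-⊛^ p k))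

poly-∷-≈ : ∀ {F G : Series} → F 0 ≡ G 0 × F ∘ suc ≈ G ∘ suc → F ≈ G
poly-∷-≈ (h , t) zero    = h
poly-∷-≈ (h , t) (suc n) = t n

-- A missing coefficient is compared as 0, so that lists differing only in trailing zeros, which `⊞`
-- and `⊛` can produce, count as equal.
poly-≈? : ∀ p q → Dec (poly p ≈ poly q)
poly-≈? []      []      = yes λ _ → refl
poly-≈? []      (b ∷ q) = map′ poly-∷-≈ (λ e → e 0 , e ∘ suc) ((0ℤ ℤ.≟ b) ×-dec poly-≈? [] q)
poly-≈? (a ∷ p) []      = map′ poly-∷-≈ (λ e → e 0 , e ∘ suc) ((a ℤ.≟ 0ℤ) ×-dec poly-≈? p [])
poly-≈? (a ∷ p) (b ∷ q) = map′ poly-∷-≈ (λ e → e 0 , e ∘ suc) ((a ℤ.≟ b) ×-dec poly-≈? p q)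

module _ (D : Series) {D₀≡1 : True (D 0 ℤ.≟ 1ℤ)} where

  /-congˡ : ∀ {F G} → F ≈ G → _/_ F D {D₀≡1} ≈ _/_ G D {D₀≡1}
  /-congˡ p zero    = p 0
  /-congˡ p (suc n) = /-congˡ (λ k → cong₂ (λ x y → x ℤ.- y ℤ.* D (suc k)) (p (suc k)) (p 0)) n

  /-zeroˡ : ∀ n → _/_ (poly []) D {D₀≡1} n ≡ 0ℤ
  /-zeroˡ zero    = refl
  /-zeroˡ (suc n) = trans (/-congˡ (λ k → z-z (D (suc k))) n) (/-zeroˡ n)
    where
    z-z : ∀ d → 0ℤ ℤ.- 0ℤ ℤ.* d ≡ 0ℤ
    z-z = solve-∀

  /-distribʳ-+ : ∀ F G → _/_ (F + G) D {D₀≡1} ≈ _/_ F D {D₀≡1} + _/_ G D {D₀≡1}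
  /-distribʳ-+ F G zero    = refl
  /-distribʳ-+ F G (suc n) =
    trans (/-congˡ (λ k → linear (F (suc k)) (G (suc k)) (F 0) (G 0) (D (suc k))) n)
          (/-distribʳ-+ (remainder F D) (remainder G D) n)
    where
    linear : ∀ a b c d e → (a ℤ.+ b) ℤ.- (c ℤ.+ d) ℤ.* e ≡ (a ℤ.- c ℤ.* e) ℤ.+ (b ℤ.- d ℤ.* e)
    linear = solve-∀

  /-sum : ∀ ps n → _/_ (poly (foldr _⊞_ [] ps)) D {D₀≡1} n
                 ≡ foldr ℤ._+_ 0ℤ (map (λ p → _/_ (poly p) D {D₀≡1} n) ps)
  /-sum []       n = /-zeroˡ n
  /-sum (p ∷ ps) n =
    trans (/-congˡ (poly-⊞ p (foldr _⊞_ [] ps)) n)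
    (trans (/-distribʳ-+ (poly p) (poly (foldr _⊞_ [] ps)) n)
           (cong (λ z → _/_ (poly p) D {D₀≡1} n ℤ.+ z) (/-sum ps n)))

-- The automaton and its generating functions

-- (z , r , s , e): z more zeros and r more copies of the current maximum m are allowed, the slack
-- asc - m is s, and e says whether the last entry is 0.  At the start m = 0 and its copies count as
-- zeros, so r = 0.
State : Set
State = ℕ × ℕ × ℕ × Bool

-- The next entry, as a function of the current maximum, and the state it leads to.
Move : Set
Move = (ℕ → ℕ) × State

rise : State → ℕ → Move
rise (z , _ , s , _) j = (λ m → suc (m ℕ.+ j)) , z , 2 , s ∸ j , false

zeroMoves repeatMoves riseMoves moves : State → List Move
zeroMoves (zero  , _ , _ , _) = []
zeroMoves (suc z , r , s , _) = (const 0 , z , r , s , true) ∷ []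
repeatMoves (_ , zero  , _ , _) = []
repeatMoves (z , suc r , s , e) = (id , z , r , (if e then suc s else s) , false) ∷ []
riseMoves q@(_ , _ , s , _) = applyUpTo (rise q) (suc s)
moves q = zeroMoves q ++ repeatMoves q ++ riseMoves q

successors : State → List State
successors q = map proj₂ (moves q)

continuations : ℕ → State → ℕ
continuations zero    q = 1
continuations (suc n) q = sum (map (continuations n) (successors q))

initial : State
initial = 2 , 0 , 0 , true

d d⁵ : List ℤ
d  = + 1 ∷ - + 1 ∷ - + 1 ∷ - + 1 ∷ []
d⁵ = d ⊛^ 5

D⁵ : Series
D⁵ = poly d ^ 5

-- The numerators over d⁵ at the states (z , 2 , s , false), obtained by multiplying computed
-- initial segments of the series by d⁵; numerator-solves certifies them.
risen : ℕ → ℕ → List ℤ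
risen 0 0 = + 1 ∷ - + 3 ∷ - + 1 ∷ + 2 ∷ + 13 ∷ + 3 ∷ - + 13 ∷ - + 28 ∷ - + 13 ∷ + 11 ∷ + 29 ∷ + 26 ∷ + 15 ∷ + 5 ∷ + 1 ∷ []
risen 0 1 = + 1 ∷ - + 2 ∷ - + 2 ∷ - + 1 ∷ + 8 ∷ + 8 ∷ + 2 ∷ - + 10 ∷ - + 13 ∷ - + 10 ∷ - + 4 ∷ - + 1 ∷ []
risen 0 2 = + 1 ∷ - + 1 ∷ - + 2 ∷ - + 3 ∷ + 2 ∷ + 5 ∷ + 6 ∷ + 3 ∷ + 1 ∷ []
risen 1 0 = + 1 ∷ - + 2 ∷ - + 2 ∷ + 0 ∷ + 7 ∷ + 9 ∷ - + 2 ∷ - + 18 ∷ - + 18 ∷ + 0 ∷ + 19 ∷ + 22 ∷ + 14 ∷ + 5 ∷ + 1 ∷ []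
risen 1 1 = + 1 ∷ - + 1 ∷ - + 1 ∷ - + 1 ∷ + 2 ∷ + 0 ∷ - + 3 ∷ - + 8 ∷ - + 2 ∷ + 3 ∷ + 6 ∷ + 3 ∷ + 1 ∷ []
risen 2 0 = + 1 ∷ - + 2 ∷ - + 1 ∷ + 1 ∷ + 9 ∷ + 3 ∷ + 0 ∷ - + 15 ∷ - + 20 ∷ - + 2 ∷ + 18 ∷ + 22 ∷ + 14 ∷ + 5 ∷ + 1 ∷ []
risen _ _ = []

-- The equation F_q = 1 + x · Σ F_q′, with q′ running over the successors of q, after multiplication
-- by `d⁵`.
system : (State → List ℤ) → State → List ℤ
system p q = d⁵ ⊞ (0ℤ ∷ foldr _⊞_ [] (map p (successors q)))

-- The fuel is the distance from a state to the states tabulated by risen, at most z + r + 1.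
unfold : ℕ → State → List ℤ
unfold _       (z , 2 , s , false) = risen z s
unfold zero    _                   = []
unfold (suc k) q                   = system (unfold k) q

numerator : State → List ℤ
-- The states in question have z ≤ 2 and r ≤ 2, hence z + r + 1 ≤ 5.
numerator = unfold 5

-- Each unit of slack costs a zero, so z + s ≤ 2 in every entry, and the entries (z , 2 , s , false)
-- are exactly those for which `risen` holds a nonempty list.
reachable : List State
reachable = initial ∷
  (1 , 0 , 0 , true) ∷ (1 , 1 , 0 , true) ∷ (1 , 2 , 0 , true) ∷
  (0 , 0 , 0 , true) ∷ (0 , 1 , 0 , true) ∷ (0 , 2 , 0 , true) ∷
  (0 , 0 , 1 , true) ∷ (0 , 1 , 1 , true) ∷ (0 , 2 , 1 , true) ∷
  (2 , 0 , 0 , false) ∷ (2 , 1 , 0 , false) ∷ (2 , 2 , 0 , false) ∷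
  (1 , 0 , 0 , false) ∷ (1 , 1 , 0 , false) ∷ (1 , 2 , 0 , false) ∷
  (1 , 0 , 1 , false) ∷ (1 , 1 , 1 , false) ∷ (1 , 2 , 1 , false) ∷
  (0 , 0 , 0 , false) ∷ (0 , 1 , 0 , false) ∷ (0 , 2 , 0 , false) ∷
  (0 , 0 , 1 , false) ∷ (0 , 1 , 1 , false) ∷ (0 , 2 , 1 , false) ∷
  (0 , 0 , 2 , false) ∷ (0 , 1 , 2 , false) ∷ (0 , 2 , 2 , false) ∷ []

_≟ₛ_ : DecidableEquality State
_≟ₛ_ = ≡-dec ℕ._≟_ (≡-dec ℕ._≟_ (≡-dec ℕ._≟_ Bool._≟_))

open import Data.List.Membership.DecPropositional _≟ₛ_ using (_∈?_)

reachable-closed : All (λ q → All (_∈ reachable) (successors q)) reachable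
reachable-closed = toWitness {a? = all? (λ q → all? (_∈? reachable) (successors q)) reachable} _

numerator-solves : All (λ q → poly (numerator q) ≈ poly (system numerator q)) reachable
numerator-solves = toWitness {a? = all? (λ q → poly-≈? (numerator q) (system numerator q)) reachable} _

pos-sum : ∀ ns → + sum ns ≡ foldr ℤ._+_ 0ℤ (map +_ ns)
pos-sum []       = refl
pos-sum (n ∷ ns) = cong (λ z → + n ℤ.+ z) (pos-sum ns)

-- Long division replays the recursion of `continuations`: by `numerator-solves` each numerator has
-- constant term 1, and its first remainder is the sum of the numerators at the successors. The
-- induction on `n` treats all reachable states at once.
continuations-gf : ∀ {q} → q ∈ reachable → ∀ n → + continuations n q ≡ (poly (numerator q) / D⁵) n
continuations-gf {q} q∈ = gf
  where
  eq : poly (numerator q) ≈ poly (system numerator q)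
  eq = All.lookup numerator-solves q∈

  rest : List ℤ
  rest = foldr _⊞_ [] (map numerator (successors q))

  cancel : ∀ a b → (a ℤ.+ b) ℤ.- 1ℤ ℤ.* a ≡ b
  cancel = solve-∀

  remainder≈ : remainder (poly (numerator q)) D⁵ ≈ poly rest
  remainder≈ n = begin
    poly (numerator q) (suc n) ℤ.- poly (numerator q) 0 ℤ.* D⁵ (suc n)
      ≡⟨ cong₂ (λ a b → a ℤ.- b ℤ.* D⁵ (suc n)) (trans (eq (suc n)) (poly-⊞ d⁵ (0ℤ ∷ rest) (suc n))) (eq 0) ⟩
    (poly d⁵ (suc n) ℤ.+ poly rest n) ℤ.- 1ℤ ℤ.* D⁵ (suc n)
      ≡⟨ cong (λ a → (a ℤ.+ poly rest n) ℤ.- 1ℤ ℤ.* D⁵ (suc n)) (poly-⊛^ d 5 (suc n)) ⟩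
    (D⁵ (suc n) ℤ.+ poly rest n) ℤ.- 1ℤ ℤ.* D⁵ (suc n)
      ≡⟨ cancel (D⁵ (suc n)) (poly rest n) ⟩
    poly rest n ∎
    where open ≡-Reasoning

  sum-gf : ∀ n qs → All (_∈ reachable) qs →
           foldr ℤ._+_ 0ℤ (map +_ (map (continuations n) qs))
         ≡ foldr ℤ._+_ 0ℤ (map (λ p → (poly p / D⁵) n) (map numerator qs))
  sum-gf n []        []         = refl
  sum-gf n (q′ ∷ qs) (q′∈ ∷ h) = cong₂ ℤ._+_ (continuations-gf q′∈ n) (sum-gf n qs h)

  gf : ∀ n → + continuations n q ≡ (poly (numerator q) / D⁵) n
  gf zero    = sym (eq 0)
  gf (suc n) = begin
    + sum (map (continuations n) (successors q))
      ≡⟨ pos-sum (map (continuations n) (successors q)) ⟩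
    foldr ℤ._+_ 0ℤ (map +_ (map (continuations n) (successors q)))
      ≡⟨ sum-gf n (successors q) (All.lookup reachable-closed q∈) ⟩
    foldr ℤ._+_ 0ℤ (map (λ p → (poly p / D⁵) n) (map numerator (successors q)))
      ≡⟨ /-sum D⁵ (map numerator (successors q)) n ⟨
    (poly rest / D⁵) n
      ≡⟨ /-congˡ D⁵ remainder≈ n ⟨
    (remainder (poly (numerator q)) D⁵ / D⁵) n ∎
    where open ≡-Reasoning


-- Ascents

-- The ascent count after appending `x` to a prefix with `a` ascents and last entry `l`; it lets the
-- ascent condition be checked letter by letter.
bump : ℕ → ℕ → ℕ → ℕ
bump a l x = if does (l ℕ.<? x) then suc a else a

bump-< : ∀ {a l x} → l < x → bump a l x ≡ suc a
bump-< {a} {l} {x} l<x rewrite dec-true (l ℕ.<? x) l<x = refl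

bump-≥ : ∀ {a l x} → x ≤ l → bump a l x ≡ a
bump-≥ {a} {l} {x} x≤l rewrite dec-false (l ℕ.<? x) (ℕ.≤⇒≯ x≤l) = refl

-- The ascent condition on a suffix w of a word whose prefix has a ascents and last entry l.
Bounded : ℕ → ℕ → List ℕ → Set
Bounded a l w = ∀ (i : Fin (length w)) → lookup w i ≤ a ℕ.+ asc (l ∷ take (toℕ i) w) ℕ.+ 1

asc-∷∷ : ∀ a l x w → a ℕ.+ asc (l ∷ x ∷ w) ≡ bump a l x ℕ.+ asc (x ∷ w)
asc-∷∷ a l x w with does (l ℕ.<? x)
... | true  = ℕ.+-suc a _
... | false = refl

Bounded-∷ : ∀ {a l x w} → Bounded a l (x ∷ w) ⇔ (x ≤ suc a × Bounded (bump a l x) x w)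
Bounded-∷ {a} {l} {x} {w} = mk⇔
  (λ h → subst (x ≤_) a+0+1 (h zero) ,
         λ i → subst (λ c → lookup w i ≤ c ℕ.+ 1) (asc-∷∷ a l x (take (toℕ i) w)) (h (suc i)))
  (λ { (x≤ , h) zero    → subst (x ≤_) (sym a+0+1) x≤
     ; (x≤ , h) (suc i) → subst (λ c → lookup w i ≤ c ℕ.+ 1) (sym (asc-∷∷ a l x (take (toℕ i) w))) (h i) })
  where
  a+0+1 : a ℕ.+ 0 ℕ.+ 1 ≡ suc a
  a+0+1 = trans (cong (ℕ._+ 1) (ℕ.+-identityʳ a)) (ℕ.+-comm a 1)

isAscentSequence-∷ : ∀ {x w} → IsAscentSequence (x ∷ w) ⇔ (x ≡ 0 × Bounded 0 x w)
isAscentSequence-∷ = mk⇔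
  (λ (first , rest) → first zero refl , λ i → rest (suc i) z<s)
  (λ (x≡0 , h) → (λ { zero _ → x≡0 }) , λ { (suc i) _ → h i })

-- Pattern avoidance

mult : ℕ → List ℕ → ℕ
mult v w = length (filter (v ℕ.≟_) w)

mult-≡ : ∀ v w → mult v (v ∷ w) ≡ suc (mult v w)
mult-≡ v w = cong length (filter-accept (v ℕ.≟_) refl)

mult-≢ : ∀ {v x} w → v ≢ x → mult v (x ∷ w) ≡ mult v w
mult-≢ {v} w v≢x = cong length (filter-reject (v ℕ.≟_) v≢x)

-- Makes the number of earlier copies of `v` a rank that increases strictly along the positions of
-- `v`.
mult-take-< : ∀ {v} w (i : Fin (length w)) n → toℕ i < n → lookup w i ≡ v →
              mult v (take (toℕ i) w) < mult v (take n w)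
mult-take-< (x ∷ w) zero    (suc n) _         refl = subst (0 <_) (sym (mult-≡ x (take n w))) z<s
mult-take-< {v} (x ∷ w) (suc i) (suc n) (s<s i<n) eq with v ℕ.≟ x | mult-take-< w i n i<n eq
... | yes refl | h = subst₂ _<_ (sym (mult-≡ v _)) (sym (mult-≡ v _)) (s<s h)
... | no v≢x   | h = subst₂ _<_ (sym (mult-≢ _ v≢x)) (sym (mult-≢ _ v≢x)) h

Positions : ℕ → List ℕ → ℕ → Set
Positions v w k = ∃ λ (is : Vec (Fin (length w)) k) →
  StrictlyIncreasing is × (∀ j → lookup w (Vec.lookup is j) ≡ v)

shift : ∀ {v x w k} → Positions v w k → Positions v (x ∷ w) k
shift {v} {x} {w} (is , inc , val) = Vec.map suc is
  , (λ j k j<k → subst₂ Fin._<_ (sym (Vec.lookup-map j suc is)) (sym (Vec.lookup-map k suc is)) (s<s (inc j k j<k)))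
  , (λ j → trans (cong (lookup (x ∷ w)) (Vec.lookup-map j suc is)) (val j))

positions : ∀ v w k → k ≤ mult v w → Positions v w k
positions v w       zero    _  = [] , (λ ()) , λ ()
positions v (x ∷ w) (suc k) k≤ with v ℕ.≟ x
... | no v≢x   = shift (positions v w (suc k) (subst (suc k ≤_) (mult-≢ w v≢x) k≤))
... | yes refl =
    let p@(is , _) = positions v w k (ℕ.≤-pred (subst (suc k ≤_) (mult-≡ v w) k≤))
        _ , inc , val = shift {v} {v} {w} {k} p
    in zero ∷ Vec.map suc is
     , (λ { zero    (suc j) _         → subst (λ i → 0 < toℕ i) (sym (Vec.lookup-map j suc is)) z<s
          ; (suc i) (suc j) (s<s i<j) → inc i j i<j })
     , λ { zero → refl ; (suc j) → val j }

-- The converse implications follow by trichotomy on the letters of `τ`: any other order of these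
-- would force a contradictory order in `π`.
orderPreserving⇒isOccurrence : ∀ τ π (is : Vec (Fin (length π)) (length τ)) →
  let π[_] = λ j → lookup π (Vec.lookup is j) in
  StrictlyIncreasing is →
  (∀ j k → lookup τ j < lookup τ k → π[ j ] < π[ k ]) →
  (∀ j k → lookup τ j ≡ lookup τ k → π[ j ] ≡ π[ k ]) →
  IsOccurrence τ π is
orderPreserving⇒isOccurrence τ π is inc mono resp =
  inc , λ j k → mk⇔ (reflects-< j k) (mono j k) , mk⇔ (reflects-≡ j k) (resp j k)
  where
  π[_] : Fin (length τ) → ℕ
  π[ j ] = lookup π (Vec.lookup is j)

  reflects-< : ∀ j k → π[ j ] < π[ k ] → lookup τ j < lookup τ k
  reflects-< j k lt with ℕ.<-cmp (lookup τ j) (lookup τ k)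
  ... | tri< τ< _ _ = τ<
  ... | tri≈ _ τ≡ _ = contradiction (resp j k τ≡) (ℕ.<⇒≢ lt)
  ... | tri> _ _ τ> = contradiction (mono k j τ>) (ℕ.<-asym lt)

  reflects-≡ : ∀ j k → π[ j ] ≡ π[ k ] → lookup τ j ≡ lookup τ k
  reflects-≡ j k eq with ℕ.<-cmp (lookup τ j) (lookup τ k)
  ... | tri< τ< _ _ = contradiction eq (ℕ.<⇒≢ (mono j k τ<))
  ... | tri≈ _ τ≡ _ = τ≡
  ... | tri> _ _ τ> = contradiction (sym eq) (ℕ.<⇒≢ (mono k j τ>))

avoids0000⇔ : ∀ {π} → Avoids π (0 ∷ 0 ∷ 0 ∷ 0 ∷ []) ⇔ (∀ v → mult v π ≤ 3)
avoids0000⇔ {π} = mk⇔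
  (λ avoids v → ℕ.≮⇒≥ λ 3<mult →
    let is , inc , val = positions v π 4 3<mult in
    avoids (is , orderPreserving⇒isOccurrence τ π is inc
      (λ j k → ⊥-elim ∘ const0≮ j k)
      (λ j k _ → trans (val j) (sym (val k)))))
  tooMany
  where
  τ : List ℕ
  τ = 0 ∷ 0 ∷ 0 ∷ 0 ∷ []

  const0 : ∀ j → lookup τ j ≡ 0
  const0 zero                   = refl
  const0 (suc zero)             = refl
  const0 (suc (suc zero))       = refl
  const0 (suc (suc (suc zero))) = refl

  const0≮ : ∀ j k → ¬ lookup τ j < lookup τ k
  const0≮ j k lt with () ← subst₂ _<_ (const0 j) (const0 k) lt

  tooMany : (∀ v → mult v π ≤ 3) → Avoids π τ
  tooMany mult≤3 (is , inc , iso) = ℕ.<⇒≱ 3<mult (mult≤3 v)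
    where
    v : ℕ
    v = lookup π (Vec.lookup is zero)

    val : ∀ j → lookup π (Vec.lookup is j) ≡ v
    val j = from (proj₂ (iso j zero)) (const0 j)

    -- The copies of `v` strictly before the `i`-th position of the occurrence. The four ranks
    -- increase strictly, so the last is at least 3, and the last position itself adds a fourth
    -- copy.
    rank : Fin 4 → ℕ
    rank i = mult v (take (toℕ (Vec.lookup is i)) π)

    rank-< : ∀ i j → i Fin.< j → rank i < rank j
    rank-< i j i<j = mult-take-< π (Vec.lookup is i) _ (inc i j i<j) (val i)

    open ℕ.≤-Reasoning

    3<mult : 3 < mult v π
    3<mult = begin-strict
      3                          ≤⟨ s≤s (s≤s (ℕ.≤-<-trans z≤n (rank-< (# 0) (# 1) z<s))) ⟩
      2 ℕ.+ rank (# 1)           ≤⟨ s≤s (rank-< (# 1) (# 2) (s<s z<s)) ⟩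
      1 ℕ.+ rank (# 2)           ≤⟨ rank-< (# 2) (# 3) (s<s (s<s z<s)) ⟩
      rank (# 3)                 <⟨ mult-take-< π (Vec.lookup is (# 3)) (length π) (Fin.toℕ<n _) (val (# 3)) ⟩
      mult v (take (length π) π) ≡⟨ cong (mult v) (take-all (length π) π ℕ.≤-refl) ⟩
      mult v π                   ∎

-- Not transitive, as `3 ≼ 0` and `0 ≼ 1` show; `Sorted` therefore constrains all pairs and not only
-- neighbours. It expresses that the nonzero entries increase weakly.
_≼_ : ℕ → ℕ → Set
x ≼ y = y ≡ 0 ⊎ x ≤ y

Sorted : List ℕ → Set
Sorted = AllPairs _≼_

lookup-AllPairs : ∀ {R : ℕ → ℕ → Set} {w} → AllPairs R w →
                  ∀ i j → i Fin.< j → R (lookup w i) (lookup w j)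
lookup-AllPairs {w = _ ∷ w} (h ∷ _)  zero    (suc j) _         = All.lookup h (∈-lookup j)
lookup-AllPairs             (_ ∷ hs) (suc i) (suc j) (s<s i<j) = lookup-AllPairs hs i j i<j

-- The leading 0 can play the smallest letter of 021, so any two nonzero entries in decreasing order
-- complete an occurrence. Conversely, the last two letters of an occurrence are such a pair.
avoids021⇔ : ∀ {w} → Avoids (0 ∷ w) (0 ∷ 2 ∷ 1 ∷ []) ⇔ Sorted (0 ∷ w)
avoids021⇔ {w} = mk⇔
  (λ avoids → All.universal (λ _ → inj₂ z≤n) w ∷
    subst Sorted (tabulate-lookup w) (AllPairs.tabulate⁺-< λ {i} {j} i<j → ordered avoids i j i<j))
  unordered
  where
  case-≼ : ∀ {x y z} → y ≼ z → x < z → z < y → ⊥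
  case-≼ (inj₁ refl) () _
  case-≼ (inj₂ y≤z)  _  z<y = ℕ.<⇒≱ z<y y≤z

  unordered : Sorted (0 ∷ w) → Avoids (0 ∷ w) (0 ∷ 2 ∷ 1 ∷ [])
  unordered sorted (is , inc , iso) =
    case-≼ (lookup-AllPairs sorted _ _ (inc (# 1) (# 2) (s<s z<s)))
           (from (proj₁ (iso (# 0) (# 2))) z<s) (from (proj₁ (iso (# 2) (# 1))) (s<s z<s))

  ordered : Avoids (0 ∷ w) (0 ∷ 2 ∷ 1 ∷ []) → ∀ i j → i Fin.< j → lookup w i ≼ lookup w j
  ordered avoids i j i<j with lookup w j ℕ.≟ 0 | lookup w i ℕ.≤? lookup w j
  ... | yes z≡0 | _       = inj₁ z≡0
  ... | no  _   | yes y≤z = inj₂ y≤z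
  ... | no  z≢0 | no  y≰z = contradiction
    (is , orderPreserving⇒isOccurrence (0 ∷ 2 ∷ 1 ∷ []) (0 ∷ w) is
      (λ { zero (suc zero) _ → z<s ; zero (suc (suc zero)) _ → z<s ; (suc zero) (suc (suc zero)) _ → s<s i<j
         ; (suc zero) (suc zero) (s<s ()) ; (suc (suc zero)) (suc zero) (s<s ()) ; (suc (suc zero)) (suc (suc zero)) (s<s (s<s ())) })
      (λ { zero (suc zero) _ → 0<y ; zero (suc (suc zero)) _ → 0<z ; (suc (suc zero)) (suc zero) _ → z<y
         ; (suc zero) (suc zero) (s<s (s<s ())) ; (suc zero) (suc (suc zero)) (s<s ())
         ; (suc (suc zero)) (suc (suc zero)) (s<s ()) })
      (λ { zero zero _ → refl ; (suc zero) (suc zero) _ → refl ; (suc (suc zero)) (suc (suc zero)) _ → refl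
         ; zero (suc zero) () ; zero (suc (suc zero)) () ; (suc zero) zero () ; (suc zero) (suc (suc zero)) ()
         ; (suc (suc zero)) zero () ; (suc (suc zero)) (suc zero) () }))
    avoids
    where
    is : Vec (Fin (length (0 ∷ w))) 3
    is = zero ∷ suc i ∷ suc j ∷ []
    0<z : 0 < lookup w j
    0<z = ℕ.n≢0⇒n>0 z≢0
    z<y : lookup w j < lookup w i
    z<y = ℕ.≰⇒> y≰z
    0<y : 0 < lookup w i
    0<y = ℕ.<-trans 0<z z<y

-- Words read by the automaton

-- The last entry of the prefix: as its nonzero entries increase weakly, this is either 0 or the
-- maximum.
latest : Bool → ℕ → ℕ
latest true  m = 0
latest false m = m

latest≤ : ∀ e m → latest e m ≤ m
latest≤ true  m = z≤n
latest≤ false m = ℕ.≤-refl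

-- w completes a prefix in the given state with maximum m, hence with m + s ascents, to an avoiding
-- ascent sequence.
Admissible : State → ℕ → List ℕ → Set
Admissible (z , r , s , e) m w =
    Bounded (m ℕ.+ s) (latest e m) w
  × Sorted (m ∷ w)
  × mult 0 w ≤ z
  × (0 < m → mult m w ≤ r)
  × (∀ v → m < v → mult v w ≤ 3)

Sorted-weaken : ∀ {l m w} → l ≤ m → Sorted (m ∷ w) → Sorted (l ∷ w)
Sorted-weaken l≤m (h ∷ hs) = All.map (λ { (inj₁ 0≡) → inj₁ 0≡ ; (inj₂ m≤) → inj₂ (ℕ.≤-trans l≤m m≤) }) h ∷ hs

-- A positive value below the current maximum can never return, which is why a state keeps no count
-- for it.
mult-absent : ∀ {v m w} → 0 < v → v < m → Sorted (m ∷ w) → mult v w ≡ 0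
mult-absent {v} 0<v v<m (h ∷ _) = cong length (filter-none (v ℕ.≟_)
  (All.map (λ { (inj₁ refl) refl → ℕ.<-irrefl refl 0<v ; (inj₂ m≤) refl → ℕ.<⇒≱ v<m m≤ }) h))

admissible-zero : ∀ {z r s e m w} →
  Admissible (suc z , r , s , e) m (0 ∷ w) ⇔ Admissible (z , r , s , true) m w
admissible-zero {z} {r} {s} {e} {m} {w} = mk⇔
  (λ { (b , (_ ∷ hm) ∷ (_ ∷ hs) , zs , rs , fs) →
      proj₂ (to Bounded-∷ b)
    , hm ∷ hs
    , ℕ.≤-pred (subst (_≤ suc z) (mult-≡ 0 w) zs)
    , (λ 0<m → subst (_≤ r) (mult-≢ w (ℕ.>⇒≢ 0<m)) (rs 0<m))
    , λ v m<v → subst (_≤ 3) (mult-≢ w (ℕ.>⇒≢ (ℕ.≤-<-trans z≤n m<v))) (fs v m<v) })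
  (λ { (b , hm ∷ hs , zs , rs , fs) →
      from Bounded-∷ (z≤n , b)
    , (inj₁ refl ∷ hm) ∷ (All.universal (λ _ → inj₂ z≤n) w ∷ hs)
    , subst (_≤ suc z) (sym (mult-≡ 0 w)) (s≤s zs)
    , (λ 0<m → subst (_≤ r) (sym (mult-≢ w (ℕ.>⇒≢ 0<m))) (rs 0<m))
    , λ v m<v → subst (_≤ 3) (sym (mult-≢ w (ℕ.>⇒≢ (ℕ.≤-<-trans z≤n m<v)))) (fs v m<v) })

-- A repeated maximum is an ascent only directly after a 0; such an ascent leaves the maximum
-- unchanged and so earns slack.
bump-repeat : ∀ e {m} s → 0 < m → bump (m ℕ.+ s) (latest e m) m ≡ m ℕ.+ (if e then suc s else s)
bump-repeat true  {m} s 0<m = trans (bump-< 0<m) (sym (ℕ.+-suc m s))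
bump-repeat false {m} s 0<m = bump-≥ {l = m} ℕ.≤-refl

admissible-repeat : ∀ {z r s e m w} → 0 < m →
  Admissible (z , suc r , s , e) m (m ∷ w) ⇔ Admissible (z , r , (if e then suc s else s) , false) m w
admissible-repeat {z} {r} {s} {e} {m} {w} 0<m = mk⇔
  (λ { (b , _ ∷ hs , zs , rs , fs) →
      subst (λ a → Bounded a m w) (bump-repeat e s 0<m) (proj₂ (to Bounded-∷ b))
    , hs
    , subst (_≤ z) (mult-≢ w (ℕ.<⇒≢ 0<m)) zs
    , (λ _ → ℕ.≤-pred (subst (_≤ suc r) (mult-≡ m w) (rs 0<m)))
    , λ v m<v → subst (_≤ 3) (mult-≢ w (ℕ.>⇒≢ m<v)) (fs v m<v) })
  (λ { (b , hs@(h ∷ _) , zs , rs , fs) →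
      from Bounded-∷ (ℕ.m≤n⇒m≤1+n (ℕ.m≤m+n m s) , subst (λ a → Bounded a m w) (sym (bump-repeat e s 0<m)) b)
    , (inj₂ ℕ.≤-refl ∷ h) ∷ hs
    , subst (_≤ z) (sym (mult-≢ w (ℕ.<⇒≢ 0<m))) zs
    , (λ _ → subst (_≤ suc r) (sym (mult-≡ m w)) (s≤s (rs 0<m)))
    , λ v m<v → subst (_≤ 3) (sym (mult-≢ w (ℕ.>⇒≢ m<v))) (fs v m<v) })

-- A new maximum always adds exactly one ascent, while the maximum grows by j + 1, so j units of
-- slack are spent.
admissible-rise : ∀ {z r s e m j w} → j ≤ s → let x = suc (m ℕ.+ j) in
  Admissible (z , r , s , e) m (x ∷ w) ⇔ Admissible (z , 2 , s ∸ j , false) x w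
admissible-rise {z} {r} {s} {e} {m} {j} {w} j≤s = mk⇔
  (λ { (b , _ ∷ hs , zs , rs , fs) →
      subst (λ a → Bounded a x w) bump-rise (proj₂ (to Bounded-∷ b))
    , hs
    , subst (_≤ z) (mult-≢ {0} {x} w λ ()) zs
    -- The copy of `x` just read is one of the three permitted, leaving 2.
    , (λ _ → ℕ.≤-pred (subst (_≤ 3) (mult-≡ x w) (fs x m<x)))
    , λ v x<v → subst (_≤ 3) (mult-≢ w (ℕ.>⇒≢ x<v)) (fs v (ℕ.<-trans m<x x<v)) })
  (λ { (b , hs , zs , rs , fs) →
      from Bounded-∷ (s≤s (ℕ.+-monoʳ-≤ m j≤s) , subst (λ a → Bounded a x w) (sym bump-rise) b)
    , Sorted-weaken m≤x (((inj₂ ℕ.≤-refl) ∷ AllPairs.head hs) ∷ hs)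
    , subst (_≤ z) (sym (mult-≢ {0} {x} w λ ())) zs
    , (λ 0<m → subst (_≤ r) (sym (trans (mult-≢ w (ℕ.<⇒≢ m<x)) (mult-absent 0<m m<x hs))) z≤n)
    , fresh hs rs fs })
  where
  x : ℕ
  x = suc (m ℕ.+ j)

  m<x : m < x
  m<x = s≤s (ℕ.m≤m+n m j)

  m≤x : m ≤ x
  m≤x = ℕ.<⇒≤ m<x

  bump-rise : bump (m ℕ.+ s) (latest e m) x ≡ x ℕ.+ (s ∸ j)
  bump-rise = trans (bump-< (ℕ.≤-<-trans (latest≤ e m) m<x)) (cong suc
    (trans (cong (m ℕ.+_) (sym (ℕ.m+[n∸m]≡n j≤s))) (sym (ℕ.+-assoc m j (s ∸ j)))))

  -- Values strictly between `m` and `x` are skipped for good, `x` itself has one copy plus at most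
  -- two more, and larger values are untouched.
  fresh : Sorted (x ∷ w) → (0 < x → mult x w ≤ 2) → (∀ v → x < v → mult v w ≤ 3) →
          ∀ v → m < v → mult v (x ∷ w) ≤ 3
  fresh hs rs fs v m<v with ℕ.<-cmp v x
  ... | tri< v<x v≢x _ = subst (_≤ 3) (sym (trans (mult-≢ w v≢x) (mult-absent (ℕ.≤-<-trans z≤n m<v) v<x hs))) z≤n
  ... | tri≈ _ refl _  = subst (_≤ 3) (sym (mult-≡ x w)) (s≤s (rs z<s))
  ... | tri> _ v≢x x<v = subst (_≤ 3) (sym (mult-≢ w v≢x)) (fs v x<v)

Admits : ℕ → ℕ → List ℕ → Move → Set
Admits m x w (letter , q) = x ≡ letter m × Admissible q (m ⊔ x) w

-- Excludes the junk states whose repeat move would append a copy of the maximum 0.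
Coherent : State → ℕ → Set
Coherent (_ , r , _ , _) m = 0 < r → 0 < m

m⊔1+[m+j] : ∀ m j → m ⊔ suc (m ℕ.+ j) ≡ suc (m ℕ.+ j)
m⊔1+[m+j] m j = ℕ.m≤n⇒m⊔n≡n (ℕ.m≤n⇒m≤1+n (ℕ.m≤m+n m j))

-- Sortedness makes `x` equal to 0, equal to `m` or larger than `m`; these cases match the zero,
-- repeat and rise moves.
admissible-∷ : ∀ q {m x w} → Coherent q m → Admissible q m (x ∷ w) ⇔ Any (Admits m x w) (moves q)
admissible-∷ q@(z , r , s , e) {m} {x} {w} coh = mk⇔ (forth q) (back q coh ∘ split)
  where
  split : Any (Admits m x w) (moves q) → Any (Admits m x w) (zeroMoves q)
        ⊎ Any (Admits m x w) (repeatMoves q) ⊎ Any (Admits m x w) (riseMoves q)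
  split p with Any.++⁻ (zeroMoves q) p
  ... | inj₁ p = inj₁ p
  ... | inj₂ p = inj₂ (Any.++⁻ (repeatMoves q) p)

  back : ∀ q → Coherent q m → Any (Admits m x w) (zeroMoves q)
       ⊎ Any (Admits m x w) (repeatMoves q) ⊎ Any (Admits m x w) (riseMoves q) →
       Admissible q m (x ∷ w)
  back q@(suc z , r , s , e) _ (inj₁ (here (refl , a))) =
    from (admissible-zero {z} {r} {s} {e}) (subst (λ m → Admissible (z , r , s , true) m w) (ℕ.⊔-identityʳ m) a)
  back q@(z , suc r , s , e) coh (inj₂ (inj₁ (here (refl , a)))) =
    from (admissible-repeat {z} {r} {s} {e} (coh z<s))
      (subst (λ m → Admissible (z , r , (if e then suc s else s) , false) m w) (ℕ.⊔-idem m) a)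
  back q@(z , r , s , e) _ (inj₂ (inj₂ p)) with Any.applyUpTo⁻ (rise q) p
  ... | j , s≤s j≤s , refl , a =
    from (admissible-rise {z} {r} {s} {e} j≤s)
      (subst (λ m → Admissible (z , 2 , s ∸ j , false) m w) (m⊔1+[m+j] m j) a)

  forth : ∀ q → Admissible q m (x ∷ w) → Any (Admits m x w) (moves q)
  forth q a with x ℕ.≟ 0
  forth (zero , _) (_ , _ , zs , _) | yes refl with () ← subst (_≤ 0) (mult-≡ 0 w) zs
  forth (suc z , r , s , e) a | yes refl =
    here (refl , subst (λ m → Admissible (z , r , s , true) m w) (sym (ℕ.⊔-identityʳ m))
                   (to (admissible-zero {z} {r} {s} {e}) a))
  forth q (_ , (inj₁ x≡0 ∷ _) ∷ _ , _) | no x≢0 = contradiction x≡0 x≢0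
  forth q a@(_ , (inj₂ m≤x ∷ _) ∷ _ , _) | no x≢0 with ℕ.m≤n⇒m<n∨m≡n m≤x
  forth q@(z , zero , _) (_ , _ , _ , rs , _) | no x≢0 | inj₂ refl
    with () ← subst (_≤ 0) (mult-≡ m w) (rs (ℕ.n≢0⇒n>0 x≢0))
  forth q@(z , suc r , s , e) a | no x≢0 | inj₂ refl =
    Any.++⁺ʳ (zeroMoves q) (Any.++⁺ˡ {xs = repeatMoves q} (here (refl ,
      subst (λ m → Admissible (z , r , (if e then suc s else s) , false) m w) (sym (ℕ.⊔-idem m))
        (to (admissible-repeat {z} {r} {s} {e} (ℕ.n≢0⇒n>0 x≢0)) a))))
  forth q@(z , r , s , e) a@(b , _) | no x≢0 | inj₁ m<x with ℕ.m≤n⇒∃[o]m+o≡n m<x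
  ... | j , refl =
    Any.++⁺ʳ (zeroMoves q) (Any.++⁺ʳ (repeatMoves q) (Any.applyUpTo⁺ (rise q) {i = j} (refl ,
      subst (λ m → Admissible (z , 2 , s ∸ j , false) m w) (sym (m⊔1+[m+j] m j))
        (to (admissible-rise {z} {r} {s} {e} j≤s) a)) (s≤s j≤s)))
    where
    -- The ascent condition at this letter reads suc (m + j) ≤ suc (m + s).
    j≤s : j ≤ s
    j≤s = ℕ.+-cancelˡ-≤ m j s (ℕ.≤-pred (proj₁ (to (Bounded-∷ {l = latest e m}) b)))

-- Enumeration of the admissible suffixes

prepend : (State → ℕ → List (List ℕ)) → ℕ → Move → List (List ℕ)
prepend next m (letter , q) = map (letter m ∷_) (next q (m ⊔ letter m))

suffixes : ℕ → State → ℕ → List (List ℕ)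
suffixes zero    q m = [] ∷ []
suffixes (suc n) q m = concatMap (prepend (suffixes n) m) (moves q)

-- The maximum determines which letters are written but not which moves are available, so the count
-- depends on the state alone.
length-suffixes : ∀ n q m → length (suffixes n q m) ≡ continuations n q
length-suffixes zero    q m = refl
length-suffixes (suc n) q m = go (moves q)
  where
  go : ∀ ps → length (concatMap (prepend (suffixes n) m) ps) ≡ sum (map (continuations n) (map proj₂ ps))
  go []                  = refl
  go ((letter , q′) ∷ ps) = trans (length-++ (map (letter m ∷_) (suffixes n q′ (m ⊔ letter m))))
    (cong₂ ℕ._+_ (trans (length-map (letter m ∷_) (suffixes n q′ (m ⊔ letter m))) (length-suffixes n q′ _)) (go ps))

CoherentMove : ℕ → Move → Set
CoherentMove m (letter , q) = Coherent q (m ⊔ letter m)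

moves-coherent : ∀ q {m} → Coherent q m → All (CoherentMove m) (moves q)
moves-coherent q@(z , r , s , e) {m} coh = All.++⁺ (zeros z) (All.++⁺ (repeats r coh) rises)
  where
  zeros : ∀ z → All (CoherentMove m) (zeroMoves (z , r , s , e))
  zeros zero    = []
  zeros (suc z) = (λ 0<r → ℕ.≤-trans (coh 0<r) (ℕ.m≤m⊔n m 0)) ∷ []

  repeats : ∀ r → Coherent (z , r , s , e) m → All (CoherentMove m) (repeatMoves (z , r , s , e))
  repeats zero    _   = []
  repeats (suc r) coh = (λ _ → ℕ.≤-trans (coh z<s) (ℕ.m≤m⊔n m m)) ∷ []

  rises : All (CoherentMove m) (riseMoves q)
  rises = All.applyUpTo⁺₂ (rise q) (suc s) λ j _ → ℕ.≤-trans z<s (ℕ.m≤n⊔m m (suc (m ℕ.+ j)))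

Distinct : ℕ → Move → Move → Set
Distinct m (letter , _) (letter′ , _) = letter m ≢ letter′ m

-- The automaton is deterministic: the next letter determines the move. Coherence is what separates
-- the letter 0 from a repeated maximum.
moves-distinct : ∀ q {m} → Coherent q m → AllPairs (Distinct m) (moves q)
moves-distinct q@(z , r , s , e) {m} coh = AllPairs.++⁺ (zeros z)
  (AllPairs.++⁺ (repeats r) rises (repeat≢rise r))
  (zero≢ z)
  where
  zeros : ∀ z → AllPairs (Distinct m) (zeroMoves (z , r , s , e))
  zeros zero    = []
  zeros (suc z) = [] ∷ []

  repeats : ∀ r → AllPairs (Distinct m) (repeatMoves (z , r , s , e))
  repeats zero    = []
  repeats (suc r) = [] ∷ []

  rises : AllPairs (Distinct m) (riseMoves q)
  rises = AllPairs.applyUpTo⁺₁ (rise q) (suc s) λ i<j _ eq → ℕ.<⇒≢ i<j (ℕ.+-cancelˡ-≡ m _ _ (ℕ.suc-injective eq))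

  repeat≢rise : ∀ r → All (λ p → All (Distinct m p) (riseMoves q)) (repeatMoves (z , r , s , e))
  repeat≢rise zero    = []
  repeat≢rise (suc r) = All.applyUpTo⁺₂ (rise q) (suc s) (λ j → ℕ.<⇒≢ (s≤s (ℕ.m≤m+n m j))) ∷ []

  zero≢repeat : ∀ r → Coherent (z , r , s , e) m → All (λ p → 0 ≢ proj₁ p m) (repeatMoves (z , r , s , e))
  zero≢repeat zero    _   = []
  zero≢repeat (suc r) coh = ℕ.<⇒≢ (coh z<s) ∷ []

  zero≢ : ∀ z → All (λ p → All (Distinct m p) (repeatMoves q ++ riseMoves q)) (zeroMoves (z , r , s , e))
  zero≢ zero    = []
  zero≢ (suc z) = All.++⁺ (zero≢repeat r coh) (All.applyUpTo⁺₂ (rise q) (suc s) (λ _ ())) ∷ []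

∈-suffixes : ∀ n q {m w} → Coherent q m → w ∈ suffixes n q m ⇔ (length w ≡ n × Admissible q m w)
∈-suffixes zero    q {w = []} coh = mk⇔
  (λ _ → refl , (λ ()) , [] ∷ [] , z≤n , (λ _ → z≤n) , λ _ _ → z≤n) (λ _ → here refl)
∈-suffixes zero    q {w = _ ∷ _} coh = mk⇔ (λ { (here ()) ; (there ()) }) λ ()
∈-suffixes (suc n) q {m} {[]} coh = mk⇔
  (λ []∈ → case Any.satisfied (∈-concatMap⁻ (prepend (suffixes n) m) {xs = moves q} []∈) of λ (_ , []∈) →
    case ∈-map⁻ _ []∈ of λ { (_ , _ , ()) })
  λ ()
∈-suffixes (suc n) q {m} {x ∷ w} coh = mk⇔
  (λ xw∈ →
    let len , a = extract (moves-coherent q coh) (∈-concatMap⁻ (prepend (suffixes n) m) {xs = moves q} xw∈)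
    in cong suc len , from (admissible-∷ q coh) a)
  (λ (len , a) → ∈-concatMap⁺ (prepend (suffixes n) m)
    (insert (ℕ.suc-injective len) (moves-coherent q coh) (to (admissible-∷ q coh) a)))
  where
  extract : ∀ {ps} → All (CoherentMove m) ps → Any ((x ∷ w ∈_) ∘ prepend (suffixes n) m) ps →
            length w ≡ n × Any (Admits m x w) ps
  extract (coh ∷ _)  (here xw∈) with _ , w∈ , refl ← ∈-map⁻ _ xw∈
    with len , a ← to (∈-suffixes n _ coh) w∈ = len , here (refl , a)
  extract (_ ∷ cohs) (there p)  with len , a ← extract cohs p = len , there a

  insert : ∀ {ps} → length w ≡ n → All (CoherentMove m) ps → Any (Admits m x w) ps →
           Any ((x ∷ w ∈_) ∘ prepend (suffixes n) m) ps
  insert len (coh ∷ _)  (here (refl , a)) = here (∈-map⁺ _ (from (∈-suffixes n _ coh) (len , a)))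
  insert len (_ ∷ cohs) (there p)         = there (insert len cohs p)

-- Blocks belonging to different moves are disjoint because their words differ in the first letter.
suffixes-unique : ∀ n q {m} → Coherent q m → Unique (suffixes n q m)
suffixes-unique zero    q coh = [] ∷ []
suffixes-unique (suc n) q {m} coh = Unique.concat⁺
  (All.map⁺ (All.map (λ coh → Unique.map⁺ ∷-injectiveʳ (suffixes-unique n _ coh)) (moves-coherent q coh)))
  (AllPairs.map⁺ (AllPairs.map (λ {p} {p′} → disjoint {p} {p′}) (moves-distinct q coh)))
  where
  disjoint : ∀ {p p′} → Distinct m p p′ →
             Disjoint (prepend (suffixes n) m p) (prepend (suffixes n) m p′)
  disjoint distinct (w∈ , w∈′) with ∈-map⁻ _ w∈ | ∈-map⁻ _ w∈′
  ... | _ , _ , refl | _ , _ , eq = distinct (∷-injectiveˡ eq)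

-- Counting the avoiding ascent sequences

avoiding⇔admissible : ∀ {w} →
  IsAvoidingAscentSequence (0 ∷ 0 ∷ 0 ∷ 0 ∷ []) (0 ∷ w) ⇔ Admissible initial 0 w
avoiding⇔admissible {w} = mk⇔
  (λ (ascent , av021 , av0000) → let mult≤3 = to avoids0000⇔ av0000 in
      proj₂ (to isAscentSequence-∷ ascent)
    , to avoids021⇔ av021
    , ℕ.≤-pred (subst (_≤ 3) (mult-≡ 0 w) (mult≤3 0))
    , (λ ())
    , λ v 0<v → subst (_≤ 3) (mult-≢ w (ℕ.>⇒≢ 0<v)) (mult≤3 v))
  (λ (bounded , sorted , zeros , _ , fresh) →
      from isAscentSequence-∷ (refl , bounded)
    , from avoids021⇔ sorted
    , from avoids0000⇔ λ
      { zero    → subst (_≤ 3) (sym (mult-≡ 0 w)) (s≤s zeros)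
      ; (suc v) → subst (_≤ 3) (sym (mult-≢ {suc v} {0} w λ ())) (fresh (suc v) z<s) })

unique∧⊆⇒length-≡ : ∀ {xs ys : List (List ℕ)} → Unique xs → Unique ys →
                    (∀ {w} → w ∈ xs → w ∈ ys) → (∀ {w} → w ∈ ys → w ∈ xs) →
                    length xs ≡ length ys
unique∧⊆⇒length-≡ xs! ys! xs⊆ys ys⊆xs = ↭-length (∼bag⇒↭ (unique∧set⇒bag xs! ys! (mk⇔ xs⊆ys ys⊆xs)))

-- The leading 0 is forced and takes one of the three zeros, which leaves `n` letters to be read
-- from `initial`. Two duplicate-free lists with the same members have equal length.
b-suc : ∀ n → b (0 ∷ 0 ∷ 0 ∷ 0 ∷ []) (suc n) ≡ continuations n initial
b-suc n = begin
  length (B τ (suc n))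
    ≡⟨ unique∧⊆⇒length-≡ {B τ (suc n)} {map (0 ∷_) (suffixes n initial 0)} (B-unique τ (suc n)) unique forth back ⟩
  length (map (0 ∷_) (suffixes n initial 0))
    ≡⟨ length-map (0 ∷_) (suffixes n initial 0) ⟩
  length (suffixes n initial 0)
    ≡⟨ length-suffixes n initial 0 ⟩
  continuations n initial ∎
  where
  open ≡-Reasoning

  τ : List ℕ
  τ = 0 ∷ 0 ∷ 0 ∷ 0 ∷ []

  coherent : Coherent initial 0
  coherent ()

  unique : Unique (map (0 ∷_) (suffixes n initial 0))
  unique = Unique.map⁺ ∷-injectiveʳ (suffixes-unique n initial coherent)

  standard⇒∈ : ∀ {w} → length w ≡ suc n × IsAvoidingAscentSequence τ w → w ∈ map (0 ∷_) (suffixes n initial 0)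
  standard⇒∈ {x ∷ w} (len , p) with refl , _ ← to isAscentSequence-∷ (proj₁ p) =
    ∈-map⁺ (0 ∷_) (from (∈-suffixes n initial coherent) (ℕ.suc-injective len , to avoiding⇔admissible p))

  ∈⇒standard : ∀ {w} → w ∈ map (0 ∷_) (suffixes n initial 0) → length w ≡ suc n × IsAvoidingAscentSequence τ w
  ∈⇒standard w∈ with w , w∈ , refl ← ∈-map⁻ (0 ∷_) w∈
    with len , a ← to (∈-suffixes n initial coherent) w∈ = cong suc len , from avoiding⇔admissible a

  forth : ∀ {w} → w ∈ B τ (suc n) → w ∈ map (0 ∷_) (suffixes n initial 0)
  forth {w} w∈ = standard⇒∈ (to (∈-B τ (suc n) w) w∈)

  back : ∀ {w} → w ∈ map (0 ∷_) (suffixes n initial 0) → w ∈ B τ (suc n)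
  back {w} w∈ = from (∈-B τ (suc n) w) (∈⇒standard w∈)

theorem3p1 : f (0 ∷ 0 ∷ 0 ∷ 0 ∷ []) ≈
    one + X * poly (+ 1 ∷ - + 3 ∷ + 0 ∷ + 3 ∷ + 11 ∷ - + 3 ∷ - + 19 ∷ - + 9 ∷ + 11 ∷ + 14 ∷ + 11 ∷ + 4 ∷ + 1 ∷ [])
    / poly (+ 1 ∷ - + 1 ∷ - + 1 ∷ - + 1 ∷ []) ^ 5
theorem3p1 zero    = refl
theorem3p1 (suc n) = begin
  f (0 ∷ 0 ∷ 0 ∷ 0 ∷ []) (suc n)                   ≡⟨ cong +_ (b-suc n) ⟩
  + continuations n initial                        ≡⟨ continuations-gf (here refl) n ⟩
  (poly (numerator initial) / D⁵) n                ≡⟨ /-congˡ D⁵ numerator≈ n ⟩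
  ((X * poly p) / D⁵) (suc n)                      ≡⟨ ℤ.+-identityˡ (((X * poly p) / D⁵) (suc n)) ⟨
  (one + X * poly p / D⁵) (suc n)                  ∎
  where
  open ≡-Reasoning

  p : List ℤ
  p = + 1 ∷ - + 3 ∷ + 0 ∷ + 3 ∷ + 11 ∷ - + 3 ∷ - + 19 ∷ - + 9 ∷ + 11 ∷ + 14 ∷ + 11 ∷ + 4 ∷ + 1 ∷ []

  X*p : poly (0ℤ ∷ numerator initial) ≈ X * poly p
  X*p = ≈-trans (toWitness {a? = poly-≈? (0ℤ ∷ numerator initial) ((0ℤ ∷ 1ℤ ∷ []) ⊛ p)} _)
                (poly-⊛ (0ℤ ∷ 1ℤ ∷ []) p)

  a≡a-0*b : ∀ a b → a ≡ a ℤ.- 0ℤ ℤ.* b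
  a≡a-0*b = solve-∀

  -- The dividend has constant term 0, so the first division step only removes the factor `X`; this
  -- shift accounts for the leading 0 of the word.
  numerator≈ : poly (numerator initial) ≈ remainder (X * poly p) D⁵
  numerator≈ k = trans (X*p (suc k)) (a≡a-0*b _ (D⁵ (suc k)))
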